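{- Let $(X,d)$ be a metric space with $n$ points and let $k\ge 1$ be an integer. The competitive ratio of $k$-barely random algorithms for metrical task systems on $(X,d)$ is at least $(2n-1)/k$; that is, if a $k$-barely random algorithm for metrical task systems on $(X,d)$ is $\alpha$-competitive, then $\alpha\ge(2n-1)/k$.
   Context: Metrical task systems (MTS) on a finite metric space $(X,d)$: the input is a sequence of cost vectors $c=(c(t))_{t\ge 1}$ with $c(t)\in\mathbb{R}_+^X$; the output is a sequence of states $\rho=(\rho(t))_{t\ge 0}$ in $X$. Its cost is $\mathrm{Cost}(\rho,c)=\sum_{t\ge 1}\big(d(\rho(t-1),\rho(t))+c_{\rho(t)}(t)\big)$, and $\mathrm{OPT}(c)=\inf_{\rho\in X^{\mathbb{N}}}\mathrm{Cost}(\rho,c)$. A $k$-barely random algorithm $\mathcal{A}$ draws one seed $s$ uniformly from $\{1,\dots,k\}$ and outputs $\rho_{\mathcal A}(t)=\mathcal{A}(c(1),\dots,c(t),s)$ for all $t\ge 0$. It is $\alpha$-competitive if there is a constant $\beta\in\mathbb{R}$ such that $\mathbb{E}_{s}[\mathrm{Cost}(\rho_{\mathcal A},c)]\le\alpha\,\mathrm{OPT}(c)+\beta$ for every cost sequence $c$. -}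

module Defs where

open import Algebra.Bundles using (CommutativeRing)
open import Data.Fin.Base using (Fin; toℕ)
open import Data.Nat.Base using (ℕ; suc)
open import Data.Product.Base using (Σ-syntax; ∃-syntax; _×_; proj₁)
open import Data.Vec.Functional using (Vector; foldr)
open import Function.Base using (flip; _∘_)
open import Function.Bundles using (_↔_)
open import Function.Metric.Structures using (IsGeneralMetric)
open import Level using (0ℓ)
open import Relation.Binary.Core using (Rel)
open import Relation.Binary.PropositionalEquality.Core using (_≡_)
open import Relation.Binary.Structures using (IsDecTotalOrder)
open import Relation.Nullary.Construct.Add.Supremum using (_⁺; [_]; ⊤⁺)
open import Relation.Nullary.Negation.Core using (¬_)
open import Relation.Unary using (Pred)
import Algebra.Definitions.RawMonoid as RawMonoidDefinitions
import Relation.Binary.Construct.Add.Supremum.NonStrict as AddSupremum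

IsSupremum : {A : Set} → Rel A 0ℓ → Pred A 0ℓ → A → Set
IsSupremum {A} _≤_ P v =
  (∀ w → P w → w ≤ v) × (∀ (u : A) → (∀ w → P w → w ≤ u) → v ≤ u)

IsInfimum : {A : Set} → Rel A 0ℓ → Pred A 0ℓ → A → Set
IsInfimum _≤_ = IsSupremum (flip _≤_)

-- The classical real numbers, given as a Dedekind-complete ordered field; this
-- determines them up to isomorphism.  Equality is a setoid equality so that,
-- for instance, Cauchy sequences of rationals form a model under excluded
-- middle, without quotients.  The value of 0# ⁻¹ is unspecified.
record RealNumbers : Set₁ where
  infix  8 _⁻¹
  infixl 7 _/_
  infix  4 _≤_
  field
    commutativeRing : CommutativeRing 0ℓ 0ℓ

  open CommutativeRing commutativeRing public

  field
    _≤_             : Rel Carrier 0ℓ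
    _⁻¹             : Carrier → Carrier
    0≉1             : ¬ (0# ≈ 1#)
    ⁻¹-cong         : ∀ {x y} → x ≈ y → x ⁻¹ ≈ y ⁻¹
    ⁻¹-inverseʳ     : ∀ x → ¬ (x ≈ 0#) → x * x ⁻¹ ≈ 1#
    isDecTotalOrder : IsDecTotalOrder _≈_ _≤_
    +-monoˡ-≤       : ∀ z {x y} → x ≤ y → x + z ≤ y + z
    *-nonNegative   : ∀ {x y} → 0# ≤ x → 0# ≤ y → 0# ≤ x * y
    complete        : (P : Pred Carrier 0ℓ) →
                      (∃[ x ] P x) →
                      (∃[ b ] (∀ x → P x → x ≤ b)) →
                      ∃[ s ] IsSupremum _≤_ P s

  _/_ : Carrier → Carrier → Carrier
  x / y = x * y ⁻¹

  open RawMonoidDefinitions +-rawMonoid public using (sum) renaming (_×_ to _·ℕ_)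

  fromℕ : ℕ → Carrier
  fromℕ m = m ·ℕ 1#

  -- Adjoining the value +∞ = ⊤⁺.
  ℝ∞ : Set
  ℝ∞ = Carrier ⁺

  open AddSupremum _≤_ public using (_≤⁺_)

  infixl 6 _+⁺_
  _+⁺_ : ℝ∞ → ℝ∞ → ℝ∞
  [ x ] +⁺ [ y ] = [ x + y ]
  [ _ ] +⁺ ⊤⁺    = ⊤⁺
  ⊤⁺    +⁺ _     = ⊤⁺

  -- The convention a · ∞ = ∞ is also used for a ≤ 0.  It is then the most
  -- permissive one: α · OPT + β imposes no bound when OPT is infinite.
  infixl 7 _*⁺_
  _*⁺_ : Carrier → ℝ∞ → ℝ∞
  a *⁺ [ x ] = [ a * x ]
  a *⁺ ⊤⁺    = ⊤⁺

  -- The expectation of v under the uniform distribution on Fin k (k nonzero).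
  mean : ∀ {k} → Vector ℝ∞ k → ℝ∞
  mean {k} v = fromℕ k ⁻¹ *⁺ foldr _+⁺_ [ 0# ] v

  -- The sum in [0,∞] of a series with nonnegative terms.
  IsSum : (ℕ → Carrier) → ℝ∞ → Set
  IsSum f = IsSupremum _≤⁺_ (λ w → ∃[ T ] w ≡ [ sum {T} (f ∘ toℕ) ])

module _ (R : RealNumbers) where
  open RealNumbers R

  record MetricSpaceOfSize (n : ℕ) : Set₁ where
    field
      X           : Set
      enumeration : X ↔ Fin n
      d           : X → X → Carrier
      isMetric    : IsGeneralMetric _≡_ _≈_ _≤_ 0# _+_ d

module MTS (R : RealNumbers) {n : ℕ} (M : MetricSpaceOfSize R n) where
  open RealNumbers R
  open MetricSpaceOfSize M

  CostVector : Set
  CostVector = Σ[ c ∈ (X → Carrier) ] (∀ x → 0# ≤ c x)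

  infix 4 _≈ᶜ_
  _≈ᶜ_ : Rel CostVector 0ℓ
  c ≈ᶜ c′ = ∀ x → proj₁ c x ≈ proj₁ c′ x

  -- The cost vector of time t ≥ 1 is stored at index t - 1, whereas states are
  -- indexed by their time t ≥ 0.
  CostSequence : Set
  CostSequence = ℕ → CostVector

  StateSequence : Set
  StateSequence = ℕ → X

  IsCost : StateSequence → CostSequence → ℝ∞ → Set
  IsCost ρ c = IsSum (λ t → d (ρ t) (ρ (suc t)) + proj₁ (c t) (ρ (suc t)))

  IsOPT : CostSequence → ℝ∞ → Set
  IsOPT c = IsInfimum _≤⁺_ (λ w → ∃[ ρ ] IsCost ρ c w)

  -- The congruence condition says that the algorithm is a function of the
  -- real-valued cost vectors, not of their representatives.
  record BarelyRandomAlgorithm (k : ℕ) : Set where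
    field
      state      : ∀ {t} → Vector CostVector t → Fin k → X
      state-cong : ∀ {t} {h h′ : Vector CostVector t} →
                   (∀ i → h i ≈ᶜ h′ i) → ∀ s → state h s ≡ state h′ s

    output : CostSequence → Fin k → StateSequence
    output c s t = state {t} (c ∘ toℕ) s

  -- Cost and OPT are uniquely determined elements of [0,∞], but telling whether
  -- they are finite is not constructive; hence they enter as relations.
  Competitive : ∀ {k} → BarelyRandomAlgorithm k → Carrier → Set
  Competitive {k} 𝒜 α =
    ∃[ β ] (∀ (c : CostSequence) (cost : Vector ℝ∞ k) (opt : ℝ∞) →
      (∀ s → IsCost (output c s) c (cost s)) →
      IsOPT c opt →
      mean cost ≤⁺ α *⁺ opt +⁺ [ β ])
    where open BarelyRandomAlgorithm 𝒜

{-# OPTIONS --safe #-}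
module Submission where

-- The adversary charges a small cost ε to the current state of the first seed only;
-- against that seed it acts as the Borodin–Linial–Saks adversary.  Keep 2n - 1 offline
-- plans: two ending in every state except the seed's current state s, and one ending
-- in s.  When the seed moves from s to s′, one of the two plans in s′ moves to s.  So
-- the total cost of the plans grows, up to a factor 1 + 2η, by at most what the seed
-- pays, and (2n - 1) OPT ≤ (1 + 2η) C, where C, the cost of the seed, is unbounded in
-- time.  The average over the k seeds is at least C / k, which forces
-- α ≥ (2n - 1) / k as η tends to 0.
--
-- The inequality to be proved is decidable, hence stable under double negation, and
-- this is what allows one to assume that the cost of each seed exists in [0,∞].

open import Data.Empty using (⊥)
open import Data.Fin.Base using (Fin; zero; suc; toℕ; punchIn)
open import Data.Fin.Properties using (toℕ<n; punchInᵢ≢i; inj⇒≟; sequence)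
open import Data.Nat.Base as ℕ using (ℕ; zero; suc; NonZero; z≤n; s≤s)
import Data.Nat.Properties as ℕ
open import Data.Product.Base using (_×_; _,_; ∃-syntax; proj₁; proj₂)
open import Data.Sum.Base using (_⊎_; inj₁; inj₂)
open import Data.Vec.Functional using (Vector; removeAt; updateAt; foldr; replicate)
open import Data.Vec.Functional.Properties using (updateAt-updates; updateAt-minimal)
open import Effect.Monad using (module RawMonad)
open import Function.Base using (_∘_; const)
open import Function.Bundles using (module Inverse)
open import Function.Metric.Structures using (module IsGeneralMetric)
open import Function.Properties.Inverse using (↔⇒↣)
open import Relation.Binary.Bundles using (Poset)
open import Relation.Binary.Definitions using (DecidableEquality)
open import Relation.Binary.PropositionalEquality as ≡ using (_≡_; _≢_)
open import Relation.Binary.Structures using (module IsDecTotalOrder)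
open import Relation.Nullary.Construct.Add.Supremum using ([_]; ⊤⁺)
open import Relation.Nullary.Decidable using (Dec; yes; no; ¬¬-excluded-middle; decidable-stable)
open import Relation.Nullary.Negation using (¬_; contradiction; ¬¬-map; ¬¬-Monad)
open import Relation.Unary using (Pred)
import Relation.Binary.Construct.Add.Supremum.NonStrict as AddSupremum
open import Defs

-- Ordered field arithmetic, suprema and infima.

module OrderedField (R : RealNumbers) where
  open RealNumbers R hiding (zero)
  open IsDecTotalOrder isDecTotalOrder public
    using (_≤?_; isPartialOrder)
    renaming ( refl to ≤-refl; reflexive to ≤-reflexive; trans to ≤-trans
             ; antisym to ≤-antisym; total to ≤-total)
  open import Algebra.Solver.Ring.NaturalCoefficients.Default commutativeSemiring
    using (solve; _:+_; _:*_; _:=_)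

  poset : Poset _ _ _
  poset = record { isPartialOrder = isPartialOrder }
  open import Relation.Binary.Reasoning.PartialOrder poset

  infix 4 _<_
  -- Since the order is total, refuting the reverse inequality yields `x ≤ y`, and a strict bound is
  -- proved by deriving a contradiction.
  _<_ : Carrier → Carrier → Set
  x < y = ¬ (y ≤ x)

  <⇒≤ : ∀ {x y} → x < y → x ≤ y
  <⇒≤ {x} {y} y≰x with ≤-total x y
  ... | inj₁ x≤y = x≤y
  ... | inj₂ y≤x = contradiction y≤x y≰x

  +-monoʳ-≤ : ∀ z {x y} → x ≤ y → z + x ≤ z + y
  +-monoʳ-≤ z {x} {y} x≤y = begin
    z + x ≈⟨ +-comm z x ⟩
    x + z ≤⟨ +-monoˡ-≤ z x≤y ⟩
    y + z ≈⟨ +-comm y z ⟩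
    z + y ∎

  +-mono-≤ : ∀ {x y u v} → x ≤ y → u ≤ v → x + u ≤ y + v
  +-mono-≤ x≤y u≤v = ≤-trans (+-monoˡ-≤ _ x≤y) (+-monoʳ-≤ _ u≤v)

  x+z-z≈x : ∀ x z → (x + z) + - z ≈ x
  x+z-z≈x x z = trans (+-assoc x z (- z)) (trans (+-congˡ (-‿inverseʳ z)) (+-identityʳ x))

  x-z+z≈x : ∀ x z → (x + - z) + z ≈ x
  x-z+z≈x x z = trans (+-assoc x (- z) z) (trans (+-congˡ (-‿inverseˡ z)) (+-identityʳ x))

  +-cancelʳ-≤ : ∀ z {x y} → x + z ≤ y + z → x ≤ y
  +-cancelʳ-≤ z {x} {y} x+z≤y+z = begin
    x             ≈⟨ x+z-z≈x x z ⟨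
    (x + z) + - z ≤⟨ +-monoˡ-≤ (- z) x+z≤y+z ⟩
    (y + z) + - z ≈⟨ x+z-z≈x y z ⟩
    y             ∎

  -- Says x - y ≈ l - r without subtraction, so that the semiring solver applies.
  ≤-by : ∀ {l r x y} → l ≤ r → x + r ≈ y + l → x ≤ y
  ≤-by {l} {r} {x} {y} l≤r x+r≈y+l = +-cancelʳ-≤ l (begin
    x + l ≤⟨ +-monoʳ-≤ x l≤r ⟩
    x + r ≈⟨ x+r≈y+l ⟩
    y + l ∎)

  x≤x+y : ∀ {x y} → 0# ≤ y → x ≤ x + y
  x≤x+y {x} {y} 0≤y = begin
    x      ≈⟨ +-identityʳ x ⟨
    x + 0# ≤⟨ +-monoʳ-≤ x 0≤y ⟩
    x + y  ∎

  x≤y+x : ∀ {x y} → 0# ≤ y → x ≤ y + x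
  x≤y+x {x} {y} 0≤y = ≤-trans (x≤x+y 0≤y) (≤-reflexive (+-comm x y))

  +-nonNegative : ∀ {x y} → 0# ≤ x → 0# ≤ y → 0# ≤ x + y
  +-nonNegative 0≤x 0≤y = ≤-trans 0≤x (x≤x+y 0≤y)

  x≤y⇒0≤y-x : ∀ {x y} → x ≤ y → 0# ≤ y + - x
  x≤y⇒0≤y-x {x} {y} x≤y = begin
    0#      ≈⟨ -‿inverseʳ x ⟨
    x + - x ≤⟨ +-monoˡ-≤ (- x) x≤y ⟩
    y + - x ∎

  *-monoʳ-≤ : ∀ {z x y} → 0# ≤ z → x ≤ y → z * x ≤ z * y
  *-monoʳ-≤ {z} {x} {y} 0≤z x≤y = begin
    z * x                     ≤⟨ x≤x+y (*-nonNegative 0≤z (x≤y⇒0≤y-x x≤y)) ⟩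
    z * x + z * (y + - x)     ≈⟨ distribˡ z x (y + - x) ⟨
    z * (x + (y + - x))       ≈⟨ *-congˡ (trans (+-comm x _) (x-z+z≈x y x)) ⟩
    z * y                     ∎

  *-monoˡ-≤ : ∀ {z x y} → 0# ≤ z → x ≤ y → x * z ≤ y * z
  *-monoˡ-≤ {z} {x} {y} 0≤z x≤y = begin
    x * z ≈⟨ *-comm x z ⟩
    z * x ≤⟨ *-monoʳ-≤ 0≤z x≤y ⟩
    z * y ≈⟨ *-comm z y ⟩
    y * z ∎

  0<1 : 0# < 1#
  0<1 1≤0 = 0≉1 (≤-antisym 0≤1 1≤0)
    where
    open import Algebra.Properties.Ring ring using (-‿distribˡ-*; -‿involutive)
    0≤-1 : 0# ≤ - 1#
    0≤-1 = ≤-trans (x≤y⇒0≤y-x 1≤0) (≤-reflexive (+-identityˡ (- 1#)))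
    0≤1 : 0# ≤ 1#
    0≤1 = begin
      0#            ≤⟨ *-nonNegative 0≤-1 0≤-1 ⟩
      - 1# * - 1#   ≈⟨ -‿distribˡ-* 1# (- 1#) ⟨
      - (1# * - 1#) ≈⟨ -‿cong (*-identityˡ (- 1#)) ⟩
      - - 1#        ≈⟨ -‿involutive 1# ⟩
      1#            ∎

  0<1+x : ∀ {x} → 0# ≤ x → 0# < 1# + x
  0<1+x 0≤x 1+x≤0 = 0<1 (≤-trans (x≤x+y 0≤x) 1+x≤0)

  <⇒≉ : ∀ {x} → 0# < x → ¬ (x ≈ 0#)
  <⇒≉ 0<x x≈0 = 0<x (≤-reflexive x≈0)

  ⁻¹-nonNegative : ∀ {x} → 0# < x → 0# ≤ x ⁻¹
  ⁻¹-nonNegative {x} 0<x with ≤-total 0# (x ⁻¹)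
  ... | inj₁ 0≤x⁻¹ = 0≤x⁻¹
  ... | inj₂ x⁻¹≤0 = contradiction 1≤0 0<1
    where
    1≤0 : 1# ≤ 0#
    1≤0 = begin
      1#       ≈⟨ ⁻¹-inverseʳ x (<⇒≉ 0<x) ⟨
      x * x ⁻¹ ≤⟨ *-monoʳ-≤ (<⇒≤ 0<x) x⁻¹≤0 ⟩
      x * 0#   ≈⟨ zeroʳ x ⟩
      0#       ∎

  *-positive : ∀ {x y} → 0# < x → 0# < y → 0# < x * y
  *-positive {x} {y} 0<x 0<y xy≤0 = 0<x (begin
    x              ≈⟨ *-identityʳ x ⟨
    x * 1#         ≈⟨ *-congˡ (⁻¹-inverseʳ y (<⇒≉ 0<y)) ⟨
    x * (y * y ⁻¹) ≈⟨ *-assoc x y _ ⟨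
    x * y * y ⁻¹   ≤⟨ *-monoˡ-≤ (⁻¹-nonNegative 0<y) xy≤0 ⟩
    0# * y ⁻¹      ≈⟨ zeroˡ _ ⟩
    0#             ∎)

  fromℕ-nonNegative : ∀ n → 0# ≤ fromℕ n
  fromℕ-nonNegative zero    = ≤-refl
  fromℕ-nonNegative (suc n) = +-nonNegative (<⇒≤ 0<1) (fromℕ-nonNegative n)

  0<fromℕ : ∀ n → 0# < fromℕ (suc n)
  0<fromℕ n = 0<1+x (fromℕ-nonNegative n)

  -- The solution is `a / (1 + b)`. It supplies the parameter `η` of the adversary.
  shrink : ∀ {a b} → 0# < a → 0# ≤ b → ∃[ e ] 0# < e × e + e * b ≈ a
  shrink {a} {b} 0<a 0≤b = e , 0<e , eq
    where
    i = (1# + b) ⁻¹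
    e = a * i
    eq : e + e * b ≈ a
    eq = begin-equality
      e + e * b        ≈⟨ +-congʳ (*-identityʳ e) ⟨
      e * 1# + e * b   ≈⟨ distribˡ e 1# b ⟨
      a * i * (1# + b) ≈⟨ *-assoc a i (1# + b) ⟩
      a * (i * (1# + b)) ≈⟨ *-congˡ (trans (*-comm i _) (⁻¹-inverseʳ _ (<⇒≉ (0<1+x 0≤b)))) ⟩
      a * 1#           ≈⟨ *-identityʳ a ⟩
      a                ∎
    0<e : 0# < e
    0<e e≤0 = 0<a (begin
      a              ≈⟨ eq ⟨
      e + e * b      ≤⟨ +-mono-≤ e≤0 (*-monoˡ-≤ 0≤b e≤0) ⟩
      0# + 0# * b    ≈⟨ trans (+-identityˡ _) (zeroˡ b) ⟩
      0#             ∎)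

  positiveLowerBound : ∀ {n} (f : Vector Carrier n) → (∀ i → 0# < f i) →
                       ∃[ δ ] 0# < δ × (∀ i → δ ≤ f i)
  positiveLowerBound {zero}  f 0<f = 1# , 0<1 , λ ()
  positiveLowerBound {suc n} f 0<f
    with δ , 0<δ , δ≤f ← positiveLowerBound (f ∘ suc) (0<f ∘ suc)
    with ≤-total (f zero) δ
  ... | inj₁ f₀≤δ = f zero , 0<f zero , λ { zero → ≤-refl ; (suc i) → ≤-trans f₀≤δ (δ≤f i) }
  ... | inj₂ δ≤f₀ = δ , 0<δ , λ { zero → δ≤f₀ ; (suc i) → δ≤f i }

  -- N offline plans cost at most l * C in total, where C is the cost of one of the κ
  -- seeds and o is the optimum; g = max (α * κ) 0, since α may be negative.
  competitive-surplus : ∀ {N g η l C o κ α β} → 0# ≤ N → 0# ≤ o → 0# ≤ g → 0# < κ →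
                        α * κ ≤ g → N ≈ g * l + η → N * o ≤ l * C → κ ⁻¹ * C ≤ α * o + β →
                        η * C ≤ N * (κ * β)
  competitive-surplus {N} {g} {η} {l} {C} {o} {κ} {α} {β} 0≤N 0≤o 0≤g 0<κ ακ≤g N≈ No≤ C≤ =
    ≤-by NC≤ (begin-equality
      η * C + (g * (l * C) + N * (κ * β))
        ≈⟨ solve 5 (λ h c g l p → h :* c :+ (g :* (l :* c) :+ p) := p :+ (g :* l :+ h) :* c)
             refl η C g l (N * (κ * β)) ⟩
      N * (κ * β) + (g * l + η) * C  ≈⟨ +-congˡ (*-congʳ N≈) ⟨
      N * (κ * β) + N * C            ∎)
    where
    NC≤ : N * C ≤ g * (l * C) + N * (κ * β)
    NC≤ = begin
      N * C                          ≈⟨ *-congˡ (*-identityˡ C) ⟨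
      N * (1# * C)                   ≈⟨ *-congˡ (*-congʳ (⁻¹-inverseʳ κ (<⇒≉ 0<κ))) ⟨
      N * (κ * κ ⁻¹ * C)             ≈⟨ *-congˡ (*-assoc κ (κ ⁻¹) C) ⟩
      N * (κ * (κ ⁻¹ * C))           ≤⟨ *-monoʳ-≤ 0≤N (*-monoʳ-≤ (<⇒≤ 0<κ) C≤) ⟩
      N * (κ * (α * o + β))
        ≈⟨ solve 5 (λ n k a o b → n :* (k :* (a :* o :+ b)) :=
                                  (a :* k) :* (n :* o) :+ n :* (k :* b))
             refl N κ α o β ⟩
      α * κ * (N * o) + N * (κ * β)  ≤⟨ +-monoˡ-≤ _ (*-monoˡ-≤ (*-nonNegative 0≤N 0≤o) ακ≤g) ⟩
      g * (N * o) + N * (κ * β)      ≤⟨ +-monoˡ-≤ _ (*-monoʳ-≤ 0≤g No≤) ⟩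
      g * (l * C) + N * (κ * β)      ∎

  -- If the values had a supremum `s`, then `s - ε` would be an upper bound too, because each value
  -- lies at least `ε` below its successor.
  archimedean : ∀ {ε} (f : ℕ → Carrier) → 0# < ε → (∀ t → f t + ε ≤ f (suc t)) →
                ∀ b → ¬ (∀ t → f t ≤ b)
  archimedean {ε} f 0<ε f+ε≤f b f≤b
    with s , s-upper , s-least ← complete (λ x → ∃[ t ] x ≡ f t) (f 0 , 0 , ≡.refl)
                                   (b , λ { _ (t , ≡.refl) → f≤b t })
    = 0<ε (≤-by s≤s-ε (begin-equality
        ε + (s + - ε)  ≈⟨ trans (+-comm ε _) (x-z+z≈x s ε) ⟩
        s              ≈⟨ +-identityˡ s ⟨
        0# + s         ∎))
    where
    s≤s-ε : s ≤ s + - ε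
    s≤s-ε = s-least (s + - ε) λ { _ (t , ≡.refl) → +-cancelʳ-≤ ε (begin
      f t + ε         ≤⟨ f+ε≤f t ⟩
      f (suc t)       ≤⟨ s-upper _ (suc t , ≡.refl) ⟩
      s               ≈⟨ x-z+z≈x s ε ⟨
      (s + - ε) + ε   ∎) }

  -- The infimum is obtained as the supremum of the set of lower bounds.
  infimum : (P : Pred Carrier _) → ∃[ x ] P x → ∃[ l ] (∀ x → P x → l ≤ x) →
            ∃[ v ] IsInfimum _≤_ P v
  infimum P (y , Py) (l , l≤P)
    with v , v-upper , v-least ← complete (λ u → ∀ x → P x → u ≤ x) (l , l≤P)
                                   (y , λ u u≤P → u≤P y Py)
    = v , (λ x Px → v-least x (λ u u≤P → u≤P x Px)) , (λ u u≤P → v-upper u u≤P)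

-- Series with nonnegative terms, infima and means in `ℝ∞`, finite sums.

module Series (R : RealNumbers) where
  open RealNumbers R hiding (zero)
  open OrderedField R
  open import Relation.Binary.Reasoning.PartialOrder poset
  open import Algebra.Properties.CommutativeMonoid.Sum +-commutativeMonoid
    using (sum-cong-≋; sum-cong-≗; sum-remove)
  open import Algebra.Solver.Ring.NaturalCoefficients.Default commutativeSemiring
    using (solve; _:+_; _:=_)
  open AddSupremum _≤_ using ([_]; _≤⊤⁺; [≤]-injective)

  partialSum : (ℕ → Carrier) → ℕ → Carrier
  partialSum f T = sum {T} (f ∘ toℕ)

  -- `sum` splits off the first term, whereas a time step appends a last one.
  partialSum-suc : ∀ f T → partialSum f (suc T) ≈ partialSum f T + f T
  partialSum-suc f zero    = +-comm (f 0) 0#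
  partialSum-suc f (suc T) =
    trans (+-congˡ (partialSum-suc (f ∘ suc) T)) (sym (+-assoc _ _ _))

  partialSum-cong : ∀ {f g} T → (∀ t → t ℕ.< T → f t ≈ g t) → partialSum f T ≈ partialSum g T
  partialSum-cong T f≈g = sum-cong-≋ {T} (λ i → f≈g (toℕ i) (toℕ<n i))

  partialSum-nonNegative : ∀ {f} → (∀ t → 0# ≤ f t) → ∀ T → 0# ≤ partialSum f T
  partialSum-nonNegative 0≤f zero    = ≤-refl
  partialSum-nonNegative 0≤f (suc T) = +-nonNegative (0≤f 0) (partialSum-nonNegative (0≤f ∘ suc) T)

  partialSum-mono : ∀ {f} → (∀ t → 0# ≤ f t) → ∀ {S T} → S ℕ.≤ T → partialSum f S ≤ partialSum f T
  partialSum-mono 0≤f {T = T} z≤n = partialSum-nonNegative 0≤f T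
  partialSum-mono 0≤f (s≤s S≤T)   = +-monoʳ-≤ _ (partialSum-mono (0≤f ∘ suc) S≤T)

  partialSum-stable : ∀ {f T} → (∀ t → T ℕ.≤ t → f t ≈ 0#) → ∀ {S} → T ℕ.≤ S →
                      partialSum f S ≈ partialSum f T
  partialSum-stable {f} {T} f≈0 = go ∘ ℕ.≤⇒≤′
    where
    go : ∀ {S} → T ℕ.≤′ S → partialSum f S ≈ partialSum f T
    go (ℕ.≤′-reflexive ≡.refl) = refl
    go (ℕ.≤′-step {S} T≤S) = begin-equality
      partialSum f (suc S)   ≈⟨ partialSum-suc f S ⟩
      partialSum f S + f S   ≈⟨ +-cong (go T≤S) (f≈0 S (ℕ.≤′⇒≤ T≤S)) ⟩
      partialSum f T + 0#    ≈⟨ +-identityʳ _ ⟩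
      partialSum f T         ∎

  finite-IsSum : ∀ {f T} → (∀ t → 0# ≤ f t) → (∀ t → T ℕ.≤ t → f t ≈ 0#) →
                 IsSum f [ partialSum f T ]
  finite-IsSum {f} {T} 0≤f f≈0 = upper , λ u f≤u → f≤u _ (T , ≡.refl)
    where
    bound : ∀ S → partialSum f S ≤ partialSum f T
    bound S with ℕ.≤-total S T
    ... | inj₁ S≤T = partialSum-mono 0≤f S≤T
    ... | inj₂ T≤S = ≤-reflexive (partialSum-stable f≈0 T≤S)
    upper : ∀ w → ∃[ S ] w ≡ [ partialSum f S ] → w ≤⁺ [ partialSum f T ]
    upper _ (S , ≡.refl) = [ bound S ]

  -- The value is a supremum if the partial sums are bounded and `⊤⁺` otherwise; this case
  -- distinction is available only under double negation.
  ¬¬IsSum : ∀ f → ¬ ¬ (∃[ v ] IsSum f v)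
  ¬¬IsSum f = ¬¬-map fromDec ¬¬-excluded-middle
    where
    fromDec : Dec (∃[ b ] (∀ T → partialSum f T ≤ b)) → ∃[ v ] IsSum f v
    fromDec (yes (b , f≤b))
      with s , s-upper , s-least ← complete (λ x → ∃[ T ] x ≡ partialSum f T)
                                     (_ , 0 , ≡.refl) (b , λ { _ (T , ≡.refl) → f≤b T })
      = [ s ]
      , (λ { _ (T , ≡.refl) → [ s-upper _ (T , ≡.refl) ] })
      , (λ { [ u ] f≤u → [ s-least u (λ { _ (T , ≡.refl) → [≤]-injective (f≤u _ (T , ≡.refl)) }) ]
           ; ⊤⁺    _   → _ ≤⊤⁺ })
    fromDec (no unbounded)
      = ⊤⁺
      , (λ w _ → w ≤⊤⁺)
      , (λ { [ u ] f≤u → contradiction (u , λ T → [≤]-injective (f≤u _ (T , ≡.refl))) unbounded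
           ; ⊤⁺    _   → _ ≤⊤⁺ })

  -- The finite members alone determine the infimum, and the finite member `y` prevents `⊤⁺` from
  -- being a lower bound.
  infimum⁺ : (P : Pred ℝ∞ _) → ∃[ x ] P [ x ] → (∀ w → P w → [ 0# ] ≤⁺ w) →
             ∃[ v ] IsInfimum _≤⁺_ P [ v ]
  infimum⁺ P (y , Py) 0≤P
    with v , v-lower , v-greatest ← infimum (P ∘ [_]) (y , Py)
                                      (0# , λ x Px → [≤]-injective (0≤P _ Px))
    = v
    , (λ { [ x ] Px → [ v-lower x Px ] ; ⊤⁺ _ → _ ≤⊤⁺ })
    , (λ { [ u ] u≤P → [ v-greatest u (λ x Px → [≤]-injective (u≤P _ Px)) ]
         ; ⊤⁺    u≤P → contradiction (u≤P _ Py) λ () })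

  foldr-nonNegative : ∀ {k} (v : Vector ℝ∞ k) → (∀ s → [ 0# ] ≤⁺ v s) →
                      [ 0# ] ≤⁺ foldr _+⁺_ [ 0# ] v
  foldr-nonNegative {zero}  v 0≤v = [ ≤-refl ]
  foldr-nonNegative {suc k} v 0≤v
    with v zero | 0≤v zero | foldr _+⁺_ [ 0# ] (v ∘ suc) | foldr-nonNegative (v ∘ suc) (0≤v ∘ suc)
  ... | [ _ ] | [ p ] | [ _ ] | [ q ] = [ +-nonNegative p q ]
  ... | [ _ ] | _     | ⊤⁺    | _     = _ ≤⊤⁺
  ... | ⊤⁺    | _     | _     | _     = _ ≤⊤⁺

  mean≥head : ∀ {k} (v : Vector ℝ∞ (suc k)) {x} → (∀ s → [ 0# ] ≤⁺ v s) → [ x ] ≤⁺ v zero →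
              [ fromℕ (suc k) ⁻¹ * x ] ≤⁺ mean v
  mean≥head {k} v 0≤v x≤v₀
    with v zero | x≤v₀ | foldr _+⁺_ [ 0# ] (v ∘ suc) | foldr-nonNegative (v ∘ suc) (0≤v ∘ suc)
  ... | [ _ ] | [ p ] | [ _ ] | [ q ] =
    [ *-monoʳ-≤ (⁻¹-nonNegative (0<fromℕ k)) (≤-trans p (x≤x+y q)) ]
  ... | [ _ ] | _     | ⊤⁺    | _     = _ ≤⊤⁺
  ... | ⊤⁺    | _     | _     | _     = _ ≤⊤⁺

  -- Both sides carry the exchanged entry, which avoids a subtraction and keeps the identity within
  -- reach of the semiring solver.
  sum-updateAt : ∀ {n} (w : Vector Carrier n) i v →
                 sum (updateAt w i (const v)) + w i ≈ sum w + v
  sum-updateAt {suc n} w i v = begin-equality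
    sum w′ + w i          ≈⟨ +-congʳ (sum-remove {i = i} w′) ⟩
    (w′ i + rest′) + w i  ≡⟨ ≡.cong₂ (λ x r → (x + r) + w i) (updateAt-updates i w)
                               (sum-cong-≗ λ j →
                                  updateAt-minimal (punchIn i j) i w (punchInᵢ≢i i j)) ⟩
    (v + rest) + w i      ≈⟨ solve 3 (λ x r y → (x :+ r) :+ y := (y :+ r) :+ x) refl v rest (w i) ⟩
    (w i + rest) + v      ≈⟨ +-congʳ (sum-remove w) ⟨
    sum w + v             ∎
    where
    w′    = updateAt w i (const v)
    rest  = sum (removeAt w i)
    rest′ = sum (removeAt w′ i)

  fromℕ*≤sum : ∀ {n x} (v : Vector Carrier n) → (∀ i → x ≤ v i) → fromℕ n * x ≤ sum v
  fromℕ*≤sum {zero}  v x≤v = ≤-reflexive (zeroˡ _)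
  fromℕ*≤sum {suc n} {x} v x≤v = begin
    (1# + fromℕ n) * x      ≈⟨ distribʳ x 1# (fromℕ n) ⟩
    1# * x + fromℕ n * x    ≈⟨ +-congʳ (*-identityˡ x) ⟩
    x + fromℕ n * x         ≤⟨ +-mono-≤ (x≤v zero) (fromℕ*≤sum (v ∘ suc) (x≤v ∘ suc)) ⟩
    sum v                   ∎

-- The adversary against a single state sequence.

module Adversary (R : RealNumbers) {m : ℕ} (M : MetricSpaceOfSize R (suc m)) where
  open RealNumbers R hiding (zero)
  open MetricSpaceOfSize M
  open MTS R M
  open OrderedField R
  open Series R
  open AddSupremum _≤_ using ([≤]-injective)
  open Inverse enumeration using (to; from; strictlyInverseˡ; strictlyInverseʳ)
  open IsGeneralMetric isMetric using (nonNegative; ≈⇒0; 0⇒≈) renaming (sym to d-sym)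
  open import Relation.Binary.Reasoning.PartialOrder poset
  open import Algebra.Properties.CommutativeMonoid.Sum +-commutativeMonoid
    using (sum-remove; sum-replicate-zero)
  open import Algebra.Solver.Ring.NaturalCoefficients.Default commutativeSemiring
    using (solve; _:+_; _:*_; _:=_; con)

  -- This is `2n - 1` for `n = m + 1`, written without subtraction.
  oddSize : Carrier
  oddSize = 1# + (fromℕ m + fromℕ m)

  0<oddSize : 0# < oddSize
  0<oddSize = 0<1+x (+-nonNegative (fromℕ-nonNegative m) (fromℕ-nonNegative m))

  infix 4 _≟_
  _≟_ : DecidableEquality X
  _≟_ = inj⇒≟ (↔⇒↣ enumeration)

  to-injective : ∀ {x y} → to x ≡ to y → x ≡ y
  to-injective {x} {y} eq =
    ≡.trans (≡.sym (strictlyInverseʳ x)) (≡.trans (≡.cong from eq) (strictlyInverseʳ y))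

  d-self : ∀ x → d x x ≈ 0#
  d-self x = ≈⇒0 ≡.refl

  -- A finite space has a least positive distance; it is bounded below row by row along the
  -- enumeration.
  separation : ∃[ δ ] 0# < δ × (∀ {x y} → x ≢ y → δ ≤ d x y)
  separation =
    let δ , 0<δ , δ≤row = positiveLowerBound _ (λ i → proj₁ (proj₂ (row i))) in
    δ , 0<δ , λ {x} {y} x≢y →
      ≡.subst₂ (λ x′ y′ → δ ≤ d x′ y′) (strictlyInverseʳ x) (strictlyInverseʳ y) (begin
        δ                                          ≤⟨ δ≤row (to x) ⟩
        proj₁ (row (to x))                         ≤⟨ proj₂ (proj₂ (row (to x))) (to y) ⟩
        proj₁ (pair (from (to x)) (from (to y)))   ≤⟨ proj₂ (proj₂ (pair _ _)) (x≢y ∘ to-injective ∘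
                                                        from-injective) ⟩
        d (from (to x)) (from (to y))              ∎)
    where
    pair : ∀ x y → ∃[ δ ] 0# < δ × (x ≢ y → δ ≤ d x y)
    pair x y with x ≟ y
    -- Equal points impose no constraint, so an arbitrary positive default keeps the minimum
    -- positive.
    ... | yes x≡y = 1# , 0<1 , contradiction x≡y
    ... | no  x≢y = d x y , (λ d≤0 → x≢y (0⇒≈ (≤-antisym d≤0 nonNegative))) , const ≤-refl
    row : ∀ i → ∃[ δ ] 0# < δ × (∀ j → δ ≤ proj₁ (pair (from i) (from j)))
    row i = positiveLowerBound _ λ j → proj₁ (proj₂ (pair (from i) (from j)))
    from-injective : ∀ {i j} → from i ≡ from j → i ≡ j
    from-injective {i} {j} eq =
      ≡.trans (≡.sym (strictlyInverseˡ i)) (≡.trans (≡.cong to eq) (strictlyInverseˡ j))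

  stepCost : StateSequence → CostSequence → ℕ → Carrier
  stepCost ρ c t = d (ρ t) (ρ (suc t)) + proj₁ (c t) (ρ (suc t))

  prefixCost : StateSequence → CostSequence → ℕ → Carrier
  prefixCost ρ c = partialSum (stepCost ρ c)

  stepCost-nonNegative : ∀ ρ c t → 0# ≤ stepCost ρ c t
  stepCost-nonNegative ρ c t = +-nonNegative nonNegative (proj₂ (c t) _)

  zeroCost : CostVector
  zeroCost = const 0# , const ≤-refl

  charge : ∀ {ε} → 0# ≤ ε → X → CostVector
  charge {ε} 0≤ε x = (λ y → cost (y ≟ x)) , (λ y → cost-nonNegative (y ≟ x))
    where
    cost : ∀ {y} → Dec (y ≡ x) → Carrier
    cost (yes _) = ε
    cost (no  _) = 0#
    cost-nonNegative : ∀ {y} (y≟x : Dec (y ≡ x)) → 0# ≤ cost y≟x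
    cost-nonNegative (yes _) = 0≤ε
    cost-nonNegative (no  _) = ≤-refl

  charge-same : ∀ {ε} (0≤ε : 0# ≤ ε) x → proj₁ (charge 0≤ε x) x ≈ ε
  charge-same 0≤ε x with x ≟ x
  ... | yes _   = refl
  ... | no  x≢x = contradiction ≡.refl x≢x

  charge-other : ∀ {ε} (0≤ε : 0# ≤ ε) {x y} → y ≢ x → proj₁ (charge 0≤ε x) y ≈ 0#
  charge-other 0≤ε {x} {y} y≢x with y ≟ x
  ... | yes y≡x = contradiction y≡x y≢x
  ... | no  _   = refl

  -- Offline plans and the optimum.

  -- A plan witnesses that `v` is an upper bound on the work function at `x` after `t` cost vectors.
  -- Resting in `x` for ever makes it a full state sequence that costs nothing more once the vectors
  -- vanish.
  Plan : CostSequence → ℕ → X → Carrier → Set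
  Plan c t x v = ∃[ ρ ] (∀ i → t ℕ.≤ i → ρ i ≡ x) × prefixCost ρ c t ≤ v

  Plan-cong : ∀ c {t x v v′} → v ≈ v′ → Plan c t x v → Plan c t x v′
  Plan-cong c v≈v′ (ρ , rests , cost≤v) = ρ , rests , ≤-trans cost≤v (≤-reflexive v≈v′)

  Plan-extend : ∀ c {t y v x e} → Plan c t y v → d y x + proj₁ (c t) x ≈ e →
                Plan c (suc t) x (v + e)
  Plan-extend c {t} {y} {v} {x} {e} (ρ , rests , cost≤v) cost≈e = ρ′ , after , (begin
    prefixCost ρ′ c (suc t)              ≈⟨ partialSum-suc (stepCost ρ′ c) t ⟩
    prefixCost ρ′ c t + stepCost ρ′ c t  ≈⟨ +-cong (partialSum-cong t same) (trans last cost≈e) ⟩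
    prefixCost ρ c t + e                 ≤⟨ +-monoˡ-≤ _ cost≤v ⟩
    v + e                                ∎)
    where
    -- Time `t` itself still belongs to the old plan, so the move from `y` to `x` is the step with
    -- index `t`.
    ρ′ : StateSequence
    ρ′ i with i ℕ.≤? t
    ... | yes _ = ρ i
    ... | no  _ = x
    before : ∀ {i} → i ℕ.≤ t → ρ′ i ≡ ρ i
    before {i} i≤t with i ℕ.≤? t
    ... | yes _   = ≡.refl
    ... | no  i≰t = contradiction i≤t i≰t
    after : ∀ i → suc t ℕ.≤ i → ρ′ i ≡ x
    after i t<i with i ℕ.≤? t
    ... | yes i≤t = contradiction i≤t (ℕ.<⇒≱ t<i)
    ... | no  _   = ≡.refl
    same : ∀ i → i ℕ.< t → stepCost ρ′ c i ≈ stepCost ρ c i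
    same i i<t = reflexive (≡.cong₂ (λ a b → d a b + proj₁ (c i) b)
                   (before (ℕ.<⇒≤ i<t)) (before i<t))
    last : stepCost ρ′ c t ≈ d y x + proj₁ (c t) x
    last = reflexive (≡.cong₂ (λ a b → d a b + proj₁ (c t) b)
             (≡.trans (before ℕ.≤-refl) (rests t ℕ.≤-refl)) (after (suc t) ℕ.≤-refl))

  -- From time `t` on the plan rests and the vectors are zero, so its whole cost is already incurred
  -- in the prefix.
  OPT≤Plan : ∀ {c t x v opt} → (∀ i → t ℕ.≤ i → c i ≡ zeroCost) →
             IsOPT c [ opt ] → Plan c t x v → opt ≤ v
  OPT≤Plan {c} {t} {x} c≡0 (lower , _) (ρ , rests , cost≤v) =
    ≤-trans ([≤]-injective (lower _ (ρ , finite-IsSum (stepCost-nonNegative ρ c) free))) cost≤v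
    where
    free : ∀ i → t ℕ.≤ i → stepCost ρ c i ≈ 0#
    free i t≤i = trans (+-cong
      (≈⇒0 (≡.trans (rests i t≤i) (≡.sym (rests (suc i) (ℕ.m≤n⇒m≤1+n t≤i)))))
      (reflexive (≡.cong (λ c → proj₁ c (ρ (suc i))) (c≡0 i t≤i)))) (+-identityʳ 0#)

  -- A constant state sequence has finite cost here, so the infimum is finite.
  OPT-exists : ∀ c T → (∀ i → T ℕ.≤ i → c i ≡ zeroCost) →
               ∃[ opt ] 0# ≤ opt × IsOPT c [ opt ]
  OPT-exists c T c≡0 =
    proj₁ opt , [≤]-injective (proj₂ (proj₂ opt) [ 0# ] cost-nonNegative) , proj₂ opt
    where
    x₀ = from zero
    cost-nonNegative : ∀ w → ∃[ ρ ] IsCost ρ c w → [ 0# ] ≤⁺ w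
    cost-nonNegative w (ρ , upper , _) = upper _ (0 , ≡.refl)
    free : ∀ i → T ℕ.≤ i → stepCost (const x₀) c i ≈ 0#
    free i T≤i = trans
      (+-cong (d-self x₀) (reflexive (≡.cong (λ c → proj₁ c x₀) (c≡0 i T≤i)))) (+-identityʳ 0#)
    opt : ∃[ o ] IsOPT c [ o ]
    opt = infimum⁺ _ (_ , const x₀ , finite-IsSum (stepCost-nonNegative _ c) free)
            cost-nonNegative

  -- Pursuit of a state sequence and the potential argument.

  module _ {η δ} (0≤η : 0# ≤ η) (0≤δ : 0# ≤ δ) (δ≤d : ∀ {x y} → x ≢ y → δ ≤ d x y) where

    -- With this choice a charge is at most `η` times any distance between distinct states.
    ε : Carrier
    ε = η * δ

    0≤ε : 0# ≤ ε
    0≤ε = *-nonNegative 0≤η 0≤δ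

    -- A step that moves over a distance D pays D, and raises the plans by at most
    -- D + 2ε ≤ loss D.
    loss : Carrier
    loss = 1# + (η + η)

    module Pursuit (r : StateSequence) where

      -- Index `t` holds the vector of time `t + 1`, so the charge falls on the state occupied just
      -- before the sequence responds.
      pursuit : CostSequence
      pursuit t = charge 0≤ε (r t)

      paid : ℕ → Carrier
      paid = prefixCost r pursuit

      pays : ℕ → Carrier
      pays = stepCost r pursuit

      StepCase : ℕ → Set
      StepCase t = (r (suc t) ≡ r t × ε ≤ loss * pays t) ⊎
                   (r (suc t) ≢ r t × (d (r (suc t)) (r t) + ε) + ε ≤ loss * pays t)

      -- Staying costs at least the charge `ε`. Moving costs exactly the distance, since the new
      -- state is not charged, and each of the two `ε` is at most `η` times that distance.
      stepCase : ∀ t → StepCase t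
      stepCase t = cases (r (suc t) ≟ r t)
        where
        cases : Dec (r (suc t) ≡ r t) → StepCase t
        cases (yes eq) = inj₁ (eq , (begin
          ε                          ≈⟨ charge-same 0≤ε (r t) ⟨
          proj₁ (pursuit t) (r t)    ≡⟨ ≡.cong (proj₁ (pursuit t)) eq ⟨
          proj₁ (pursuit t) (r (suc t)) ≤⟨ x≤y+x nonNegative ⟩
          pays t                     ≤⟨ x≤x+y (*-nonNegative (+-nonNegative 0≤η 0≤η) 0≤pays) ⟩
          pays t + (η + η) * pays t
            ≈⟨ solve 2 (λ a h → a :+ (h :+ h) :* a := (con 1 :+ (h :+ h)) :* a) refl (pays t) η ⟩
          loss * pays t              ∎))
          where
          0≤pays : 0# ≤ pays t
          0≤pays = stepCost-nonNegative r pursuit t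
        cases (no neq) = inj₂ (neq , (begin
          (d (r (suc t)) (r t) + ε) + ε       ≈⟨ +-congʳ (+-congʳ d≈pays) ⟩
          (pays t + ε) + ε                    ≤⟨ +-mono-≤ (+-monoʳ-≤ (pays t) ε≤η*pays) ε≤η*pays ⟩
          (pays t + η * pays t) + η * pays t
            ≈⟨ solve 2 (λ a h → (a :+ h :* a) :+ h :* a := (con 1 :+ (h :+ h)) :* a)
                 refl (pays t) η ⟩
          loss * pays t                       ∎))
          where
          d≈pays : d (r (suc t)) (r t) ≈ pays t
          d≈pays = trans (d-sym _ _) (sym (trans (+-congˡ (charge-other 0≤ε neq)) (+-identityʳ _)))
          ε≤η*pays : ε ≤ η * pays t
          ε≤η*pays = *-monoʳ-≤ 0≤η (≤-trans (δ≤d neq) (≤-reflexive d≈pays))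

      loss*paid-suc : ∀ t → loss * paid (suc t) ≈ loss * paid t + loss * pays t
      loss*paid-suc t = trans (*-congˡ (partialSum-suc pays t)) (distribˡ _ _ _)

      growth : ∀ t → loss * paid t + ε ≤ loss * paid (suc t)
      growth t = begin
        loss * paid t + ε             ≤⟨ +-monoʳ-≤ _ ε≤ ⟩
        loss * paid t + loss * pays t ≈⟨ loss*paid-suc t ⟨
        loss * paid (suc t)           ∎
        where
        ε≤ : ε ≤ loss * pays t
        ε≤ with stepCase t
        ... | inj₁ (_ , le) = le
        ... | inj₂ (_ , le) = ≤-trans (x≤y+x (+-nonNegative nonNegative 0≤ε)) le

      -- Two offline plans end in each state other than r t and one ends in r t: 2n - 1 in all.
      Potential : ℕ → Set
      Potential t = ∃[ w ] (∀ x → Plan pursuit t x (w (to x))) ×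
                           sum w + sum w ≤ w (to (r t)) + loss * paid t

      -- By induction on time. Only the charged state `r t` needs a new plan; in every other state
      -- the old plan rests for free.
      potential : ∀ t → Potential t
      -- An offline sequence may start in any state, so every state is reached at cost zero.
      potential zero = zeros , (λ x → const x , (λ _ _ → ≡.refl) , ≤-refl) , (begin
        sum zeros + sum zeros  ≈⟨ +-cong zeros≈0 zeros≈0 ⟩
        0# + 0#                ≈⟨ +-congˡ (zeroʳ loss) ⟨
        0# + loss * paid 0     ∎)
        where
        zeros   = replicate (suc m) 0#
        zeros≈0 = sum-replicate-zero (suc m)
      potential (suc t) with w , plan , bound ← potential t = w′ , plan′ , bound′
        where
        s  = r t
        s′ = r (suc t)
        ws = w (to s)

        stay : Carrier
        stay = ws + ε

        move : Carrier
        move = w (to s′) + (d s′ s + ε)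

        planStay : Plan pursuit (suc t) s stay
        planStay = Plan-extend pursuit (plan s)
          (trans (+-cong (d-self s) (charge-same 0≤ε s)) (+-identityˡ ε))

        planMove : Plan pursuit (suc t) s move
        planMove = Plan-extend pursuit (plan s′) (+-congˡ (charge-same 0≤ε s))

        -- Both plans that end in `s` are recorded by one number, so it has to lie below both
        -- candidates.
        best : ∃[ v ] Plan pursuit (suc t) s v × v ≤ stay × v ≤ move
        best with ≤-total stay move
        ... | inj₁ stay≤move = stay , planStay , ≤-refl , stay≤move
        ... | inj₂ move≤stay = move , planMove , move≤stay , ≤-refl

        v : Carrier
        v = proj₁ best
        v≤stay = proj₁ (proj₂ (proj₂ best))
        v≤move = proj₂ (proj₂ (proj₂ best))

        w′ : Vector Carrier (suc m)
        w′ = updateAt w (to s) (const v)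

        w′-other : ∀ {x} → x ≢ s → w′ (to x) ≡ w (to x)
        w′-other x≢s = updateAt-minimal _ _ w (x≢s ∘ to-injective)

        plan′ : ∀ x → Plan pursuit (suc t) x (w′ (to x))
        plan′ x with x ≟ s
        ... | yes ≡.refl = ≡.subst (Plan pursuit (suc t) s) (≡.sym (updateAt-updates (to s) w))
                             (proj₁ (proj₂ best))
        ... | no  x≢s    = ≡.subst (Plan pursuit (suc t) x) (≡.sym (w′-other x≢s))
          (Plan-cong pursuit (+-identityʳ _) (Plan-extend pursuit (plan x)
            (trans (+-cong (d-self x) (charge-other 0≤ε x≢s)) (+-identityʳ 0#))))

        -- This is what preserves the invariant when `ws` is replaced by `v`. If the sequence stays,
        -- one copy of `v` is the new entry itself; if it moves, one copy is bounded by `stay` and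
        -- the other by `move`.
        2v≤ : v + v ≤ (w′ (to s′) + ws) + loss * pays t
        2v≤ with stepCase t
        ... | inj₁ (eq , ε≤) = begin
          v + v                              ≤⟨ +-monoʳ-≤ v (≤-trans v≤stay (+-monoʳ-≤ _ ε≤)) ⟩
          v + (ws + loss * pays t)           ≈⟨ +-assoc _ _ _ ⟨
          (v + ws) + loss * pays t           ≡⟨ ≡.cong (λ u → (u + ws) + loss * pays t)
                                                  (updateAt-updates (to s) w) ⟨
          (w′ (to s) + ws) + loss * pays t   ≡⟨ ≡.cong (λ x → (w′ (to x) + ws) + loss * pays t) eq ⟨
          (w′ (to s′) + ws) + loss * pays t  ∎
        ... | inj₂ (neq , d+2ε≤) = begin
          v + v                              ≤⟨ +-mono-≤ v≤move v≤stay ⟩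
          move + stay
            ≈⟨ solve 4 (λ x y e f → (x :+ (f :+ e)) :+ (y :+ e) := (x :+ y) :+ ((f :+ e) :+ e))
                 refl (w (to s′)) ws ε (d s′ s) ⟩
          (w (to s′) + ws) + ((d s′ s + ε) + ε)  ≤⟨ +-monoʳ-≤ _ d+2ε≤ ⟩
          (w (to s′) + ws) + loss * pays t   ≡⟨ ≡.cong (λ u → (u + ws) + loss * pays t)
                                                  (w′-other neq) ⟨
          (w′ (to s′) + ws) + loss * pays t  ∎

        bound′ : sum w′ + sum w′ ≤ w′ (to s′) + loss * paid (suc t)
        bound′ = ≤-by (+-mono-≤ 2v≤ bound) (begin-equality
          (sum w′ + sum w′) + (((w′ (to s′) + ws) + loss * pays t) + (ws + loss * paid t))
            ≈⟨ solve 5 (λ W ws x p q → (W :+ W) :+ (((x :+ ws) :+ p) :+ (ws :+ q)) :=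
                                       (x :+ (q :+ p)) :+ ((W :+ ws) :+ (W :+ ws)))
                 refl (sum w′) ws (w′ (to s′)) (loss * pays t) (loss * paid t) ⟩
          (w′ (to s′) + (loss * paid t + loss * pays t)) + ((sum w′ + ws) + (sum w′ + ws))
            ≈⟨ +-cong (+-congˡ (loss*paid-suc t)) (+-cong exchange exchange) ⟨
          (w′ (to s′) + loss * paid (suc t)) + ((sum w + v) + (sum w + v))
            ≈⟨ +-congˡ (solve 2 (λ W v → (W :+ v) :+ (W :+ v) := (v :+ v) :+ (W :+ W))
                          refl (sum w) v) ⟩
          (w′ (to s′) + loss * paid (suc t)) + ((v + v) + (sum w + sum w)) ∎)
          where
          exchange : sum w + v ≈ sum w′ + ws
          exchange = sym (sum-updateAt w (to s) v)

      -- Each of the `2n - 1` plans counted by the potential costs at least `opt`; splitting off the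
      -- entry of `r t` leaves it once and the other `m` entries twice.
      offline : ∀ t {opt} → (∀ {x v} → Plan pursuit t x v → opt ≤ v) →
                oddSize * opt ≤ loss * paid t
      offline t {o} o≤ with w , plan , bound ← potential t = begin
        oddSize * o
          ≈⟨ solve 2 (λ n o → (con 1 :+ (n :+ n)) :* o := o :+ (n :* o :+ n :* o))
               refl (fromℕ m) o ⟩
        o + (fromℕ m * o + fromℕ m * o)    ≤⟨ +-mono-≤ (o≤w s) (+-mono-≤ mo≤rest mo≤rest) ⟩
        w s + (rest + rest)                ≤⟨ ≤-by bound split ⟩
        loss * paid t                      ∎
        where
        s = to (r t)
        rest = sum (removeAt w s)
        o≤w : ∀ i → o ≤ w i
        o≤w i = ≤-trans (o≤ (plan (from i)))
          (≤-reflexive (reflexive (≡.cong w (strictlyInverseˡ i))))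
        mo≤rest : fromℕ m * o ≤ rest
        mo≤rest = fromℕ*≤sum (removeAt w s) (o≤w ∘ punchIn s)
        split : (w s + (rest + rest)) + (w s + loss * paid t) ≈ loss * paid t + (sum w + sum w)
        split = trans
          (solve 3 (λ x q p → (x :+ (p :+ p)) :+ (x :+ q) := q :+ ((x :+ p) :+ (x :+ p)))
            refl (w s) (loss * paid t) rest)
          (+-congˡ (sym (+-cong (sum-remove w) (sum-remove w))))

-- From the pursuit of the first seed to the competitive ratio.

module LowerBound (R : RealNumbers) {m : ℕ} (M : MetricSpaceOfSize R (suc m)) where
  open RealNumbers R hiding (zero)
  open MetricSpaceOfSize M
  open MTS R M
  open OrderedField R
  open Series R
  open Adversary R M
  open AddSupremum _≤_ using ([_]; ≤⁺-trans; [≤]-injective)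
  open import Relation.Binary.Reasoning.PartialOrder poset
  open import Algebra.Properties.CommutativeSemigroup *-commutativeSemigroup using (x∙yz≈y∙xz)
  open import Algebra.Solver.Ring.NaturalCoefficients.Default commutativeSemiring
    using (solve; _:+_; _:*_; _:=_; con)

  -- The first T cost vectors of the adversary that answers the current state x by
  -- next x, followed by zero vectors so that the optimum is finite.
  module History (𝓈 : ∀ {t} → Vector CostVector t → X) (next : X → CostVector) where

    history : ℕ → CostSequence
    history zero    i = zeroCost
    history (suc T) i with i ℕ.≟ T
    ... | yes _ = next (𝓈 {T} (history T ∘ toℕ))
    ... | no  _ = history T i

    -- The state at time `t` reads only the first `t` vectors, so one sequence serves all longer
    -- histories.
    current : StateSequence
    current t = 𝓈 {t} (history t ∘ toℕ)

    history-after : ∀ T i → T ℕ.≤ i → history T i ≡ zeroCost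
    history-after zero    i T≤i = ≡.refl
    history-after (suc T) i T<i with i ℕ.≟ T
    ... | yes i≡T = contradiction (≡.sym i≡T) (ℕ.<⇒≢ T<i)
    ... | no  _   = history-after T i (ℕ.<⇒≤ T<i)

    history-before : ∀ T i → i ℕ.< T → history T i ≡ next (current i)
    history-before (suc T) i i<1+T with i ℕ.≟ T
    ... | yes ≡.refl = ≡.refl
    ... | no  i≢T    = history-before T i (ℕ.≤∧≢⇒< (ℕ.s≤s⁻¹ i<1+T) i≢T)

  module _ {k : ℕ} (𝒜 : BarelyRandomAlgorithm (suc k)) {η δ}
           (0≤η : 0# ≤ η) (0≤δ : 0# ≤ δ) (δ≤d : ∀ {x y} → x ≢ y → δ ≤ d x y)
           {α β : Carrier}
           (competitive : ∀ c (cost : Vector ℝ∞ (suc k)) opt →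
                          (∀ s → IsCost (BarelyRandomAlgorithm.output 𝒜 c s) c (cost s)) →
                          IsOPT c opt → mean cost ≤⁺ α *⁺ opt +⁺ [ β ])
           where
    open BarelyRandomAlgorithm 𝒜
    open History (λ h → state h zero) (charge (0≤ε 0≤η 0≤δ δ≤d))
    open Pursuit 0≤η 0≤δ δ≤d current

    -- The histories of lengths `t` and `T` share their first `t` vectors. They agree only
    -- pointwise, and `state-cong` turns this into equal states.
    output-current : ∀ T t → t ℕ.≤ T → output (history T) zero t ≡ current t
    output-current T t t≤T = state-cong
      (λ i x → reflexive (≡.cong (λ c → proj₁ c x) (agree (toℕ<n i)))) zero
      where
      agree : ∀ {i} → i ℕ.< t → history T i ≡ history t i
      agree i<t =
        ≡.trans (history-before T _ (ℕ.<-≤-trans i<t t≤T)) (≡.sym (history-before t _ i<t))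

    prefixCost-output : ∀ T → prefixCost (output (history T) zero) (history T) T ≈ paid T
    prefixCost-output T = partialSum-cong T λ t t<T →
      reflexive (≡.cong₂ _+_
        (≡.cong₂ d (output-current T t (ℕ.<⇒≤ t<T)) (output-current T (suc t) t<T))
        (≡.cong₂ proj₁ (history-before T t t<T) (output-current T (suc t) t<T)))

    competitive-pursuit : ∀ T → ∃[ o ] 0# ≤ o × oddSize * o ≤ loss 0≤η 0≤δ δ≤d * paid T ×
                          fromℕ (suc k) ⁻¹ * paid T ≤ α * o + β
    competitive-pursuit T with o , 0≤o , isOPT ← OPT-exists (history T) T (history-after T)
      = o , 0≤o , offline T (λ plan → OPT≤Plan (history-after T) isOPT (transfer plan)) ,
        -- There are finitely many seeds, so their double negations combine into one, which the
        -- decidable inequality absorbs.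
        decidable-stable (_ ≤? _)
          (¬¬-map bound (sequence (RawMonad.rawApplicative ¬¬-Monad) λ s →
            ¬¬IsSum (stepCost (output c s) c)))
      where
      c = history T
      -- A plan is priced on the first `T` vectors only, and there `pursuit` and `history T`
      -- coincide.
      transfer : ∀ {x v} → Plan pursuit T x v → Plan c T x v
      transfer (ρ , rests , cost≤v) = ρ , rests , ≤-trans (≤-reflexive
        (partialSum-cong T λ t t<T → reflexive (≡.cong
          (λ cₜ → d (ρ t) (ρ (suc t)) + proj₁ cₜ (ρ (suc t))) (history-before T t t<T)))) cost≤v
      bound : (∀ s → ∃[ v ] IsCost (output c s) c v) → fromℕ (suc k) ⁻¹ * paid T ≤ α * o + β
      bound cost = [≤]-injective (≤⁺-trans ≤-trans
        (mean≥head (proj₁ ∘ cost) (λ s → proj₁ (proj₂ (cost s)) _ (0 , ≡.refl))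
          (≤⁺-trans ≤-trans [ ≤-reflexive (sym (prefixCost-output T)) ]
            (proj₁ (proj₂ (cost zero)) _ (T , ≡.refl))))
        (competitive c (proj₁ ∘ cost) [ o ] (proj₂ ∘ cost) isOPT))

    -- The surplus `η` bounds the cost of the first seed by a constant independent of `T`, while
    -- `growth` makes that cost exceed every bound.
    refute : ∀ {g} → 0# < η → 0# < δ → α * fromℕ (suc k) ≤ g → 0# ≤ g →
             oddSize ≈ g * loss 0≤η 0≤δ δ≤d + η → ⊥
    refute {g} 0<η 0<δ ακ≤g 0≤g N≈ =
      archimedean (λ T → η * (l * paid T)) (*-positive 0<η (*-positive 0<η 0<δ))
        (λ T → ≤-trans (≤-reflexive (sym (distribˡ η _ _))) (*-monoʳ-≤ 0≤η (growth T)))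
        (l * (oddSize * (fromℕ (suc k) * β)))
        (λ T → bounded T (competitive-pursuit T))
      where
      l = loss 0≤η 0≤δ δ≤d
      0≤l : 0# ≤ l
      0≤l = <⇒≤ (0<1+x (+-nonNegative 0≤η 0≤η))
      bounded : ∀ T → ∃[ o ] 0# ≤ o × oddSize * o ≤ l * paid T ×
                             fromℕ (suc k) ⁻¹ * paid T ≤ α * o + β →
                η * (l * paid T) ≤ l * (oddSize * (fromℕ (suc k) * β))
      bounded T (o , 0≤o , No≤ , C≤) = begin
        η * (l * paid T)   ≈⟨ x∙yz≈y∙xz η l (paid T) ⟩
        l * (η * paid T)   ≤⟨ *-monoʳ-≤ 0≤l (competitive-surplus
                                (<⇒≤ 0<oddSize) 0≤o 0≤g (0<fromℕ k) ακ≤g N≈ No≤ C≤) ⟩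
        l * (oddSize * (fromℕ (suc k) * β))  ∎

  module _ {k : ℕ} (𝒜 : BarelyRandomAlgorithm (suc k)) {α : Carrier}
           (competitive : Competitive 𝒜 α) where

    private
      κ = fromℕ (suc k)
      N = oddSize

    -- If `g < N`, some positive `η` solves `η * (1 + 2g) = N - g`. Then `N = g * (1 + 2η) + η`,
    -- which leaves the surplus `η` to be refuted.
    not-below : ∀ {g} → α * κ ≤ g → 0# ≤ g → ¬ (g < N)
    not-below {g} ακ≤g 0≤g g<N = choose (shrink N-g>0 (+-nonNegative 0≤g 0≤g)) separation
      where
      N-g>0 : 0# < N + - g
      N-g>0 N-g≤0 = g<N (≤-by N-g≤0 (trans (+-identityʳ N) (sym (trans (+-comm g _) (x-z+z≈x N g)))))
      N≈ : ∀ {η} → η + η * (g + g) ≈ N + - g → N ≈ g * (1# + (η + η)) + η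
      N≈ {η} η-eq = begin-equality
        N                       ≈⟨ x-z+z≈x N g ⟨
        (N + - g) + g           ≈⟨ +-congʳ η-eq ⟨
        (η + η * (g + g)) + g
          ≈⟨ solve 2 (λ h g → (h :+ h :* (g :+ g)) :+ g := g :* (con 1 :+ (h :+ h)) :+ h) refl η g ⟩
        g * (1# + (η + η)) + η  ∎
      choose : ∃[ η ] 0# < η × η + η * (g + g) ≈ N + - g →
               ∃[ δ ] 0# < δ × (∀ {x y} → x ≢ y → δ ≤ d x y) → ⊥
      choose (η , 0<η , η-eq) (δ , 0<δ , δ≤d) =
        refute 𝒜 (<⇒≤ 0<η) (<⇒≤ 0<δ) δ≤d (proj₂ competitive) 0<η 0<δ ακ≤g 0≤g (N≈ η-eq)

    N≤ακ : N ≤ α * κ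
    N≤ακ = decidable-stable (_ ≤? _) λ ακ<N → case ακ<N (≤-total 0# (α * κ))
      where
      case : α * κ < N → 0# ≤ α * κ ⊎ α * κ ≤ 0# → ⊥
      case ακ<N (inj₁ 0≤ακ) = not-below ≤-refl 0≤ακ ακ<N
      -- A nonpositive ratio is replaced by `g = 0`, which is still below `N`.
      case ακ<N (inj₂ ακ≤0) = not-below ακ≤0 ≤-refl 0<oddSize

    ratio : (fromℕ 2 * fromℕ (suc m) - 1#) / κ ≤ α
    ratio = begin
      (fromℕ 2 * fromℕ (suc m) - 1#) * κ ⁻¹ ≈⟨ *-congʳ numerator ⟩
      N * κ ⁻¹        ≤⟨ *-monoˡ-≤ (⁻¹-nonNegative (0<fromℕ k)) N≤ακ ⟩
      α * κ * κ ⁻¹    ≈⟨ *-assoc α κ _ ⟩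
      α * (κ * κ ⁻¹)  ≈⟨ *-congˡ (⁻¹-inverseʳ κ (<⇒≉ (0<fromℕ k))) ⟩
      α * 1#          ≈⟨ *-identityʳ α ⟩
      α               ∎
      where
      numerator : fromℕ 2 * fromℕ (suc m) - 1# ≈ N
      numerator = begin-equality
        fromℕ 2 * (1# + fromℕ m) - 1#  ≈⟨ +-congʳ (*-congʳ (+-congˡ (+-identityʳ 1#))) ⟩
        (1# + 1#) * (1# + fromℕ m) - 1#
          ≈⟨ +-congʳ (solve 1 (λ n → (con 1 :+ con 1) :* (con 1 :+ n) :=
                                     (con 1 :+ (n :+ n)) :+ con 1) refl (fromℕ m)) ⟩
        (N + 1#) - 1#                  ≈⟨ x+z-z≈x N 1# ⟩
        N                              ∎

proposition4p2 : (R : RealNumbers) (n : ℕ) (M : MetricSpaceOfSize R n) (k : ℕ) .{{_ : NonZero k}} →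
    let open RealNumbers R
        open MTS R M
    in (𝒜 : BarelyRandomAlgorithm k) (α : Carrier) →
       Competitive 𝒜 α →
       (fromℕ 2 * fromℕ n - 1#) / fromℕ k ≤ α
proposition4p2 R (suc m) M (suc k) 𝒜 α competitive = LowerBound.ratio R M 𝒜 competitive
-- On an empty space no algorithm exists: its state for the empty history would yield an element of
-- `Fin 0`.
proposition4p2 R zero M (suc k) 𝒜 α competitive
  with () ← Inverse.to (MetricSpaceOfSize.enumeration M)
              (MTS.BarelyRandomAlgorithm.state 𝒜 {0} (λ ()) zero)
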